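{- Let $(P,\leqslant)$ be a locally finite poset having a minimum element $\hat{0}$. Suppose that for every nonempty finite subset $S \subset P$ there exists an element $z \in S$ such that there are infinitely many $x \in P$ with $x \geqslant z$ but $x \not\geqslant y$ for every $y \in S\setminus\{z\}$. Then $P$ has the Möbius uncertainty property: whenever $f,g : P \to \mathbb{C}$ are functions, neither identically zero, satisfying \[ g(z) = \sum_{x \in P,\ x \leqslant z} f(x) \quad \text{for every } z \in P, \] at least one of $\operatorname{supp}(f) = \{x \in P : f(x)\neq 0\}$ and $\operatorname{supp}(g)=\{x\in P: g(x)\neq 0\}$ is infinite.
   Context: A poset is locally finite if every interval $\{z : x \leqslant z \leqslant y\}$ is finite; in particular the sum defining $g$ is finite. -}

module Defs where

open import Level using (Level; _⊔_; suc; 0ℓ)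
open import Algebra.Bundles using (CommutativeMonoid)
import Algebra.Construct.DirectProduct as DirectProduct
open import Data.List.Base using (List; foldr; map)
import Data.List.Membership.Setoid as Membership
import Data.List.Relation.Unary.Unique.Setoid as Uniqueness
open import Data.Nat.Base as ℕ using (ℕ)
import Data.Nat.Properties as ℕ
open import Data.Product.Base using (Σ-syntax; ∃; ∃-syntax; _×_; _,_; proj₁; proj₂)
open import Data.Rational.Base as ℚ using (ℚ; 0ℚ; ½; ∣_∣; _-_)
import Data.Rational.Properties as ℚ
import Data.Rational.Solver as ℚ-Solver
open import Data.Sum.Base using (_⊎_)
open import Function.Bundles using (Func; _⇔_; mk⇔; Equivalence)
open import Relation.Binary.Bundles using (Setoid; Poset)
open import Relation.Binary.Core using (Rel)
open import Relation.Binary.Definitions using (Minimum)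
open import Relation.Binary.PropositionalEquality using (_≡_; refl; sym; trans; cong; cong₂; subst)
open import Relation.Nullary.Negation.Core using (¬_)
open import Relation.Unary using (Pred)

-- Real numbers: Cauchy sequences of rationals, where two sequences are
-- equal when their difference tends to 0.

record ℝ : Set where
  constructor mkℝ
  field
    seq    : ℕ → ℚ
    cauchy : ∀ ε → 0ℚ ℚ.< ε →
             ∃[ N ] (∀ m n → N ℕ.≤ m → N ℕ.≤ n → ∣ seq m - seq n ∣ ℚ.< ε)

open ℝ public

infix 4 _≈ℝ_
_≈ℝ_ : Rel ℝ 0ℓ
x ≈ℝ y = ∀ ε → 0ℚ ℚ.< ε →
         ∃[ N ] (∀ n → N ℕ.≤ n → ∣ seq x n - seq y n ∣ ℚ.< ε)

private
  half-pos : ∀ {ε} → 0ℚ ℚ.< ε → 0ℚ ℚ.< ½ ℚ.* ε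
  half-pos {ε} 0<ε =
    subst (ℚ._< ½ ℚ.* ε) (ℚ.*-zeroʳ ½) (ℚ.*-monoʳ-<-pos ½ 0<ε)

  halves : ∀ ε → ½ ℚ.* ε ℚ.+ ½ ℚ.* ε ≡ ε
  halves ε = trans (sym (ℚ.*-distribʳ-+ ε ½ ½)) (ℚ.*-identityˡ ε)

  ∣sum∣< : ∀ {a b c ε} → a ≡ b ℚ.+ c →
           ∣ b ∣ ℚ.< ½ ℚ.* ε → ∣ c ∣ ℚ.< ½ ℚ.* ε → ∣ a ∣ ℚ.< ε
  ∣sum∣< {b = b} {c} {ε} refl b< c< =
    ℚ.≤-<-trans (ℚ.∣p+q∣≤∣p∣+∣q∣ b c)
      (subst (∣ b ∣ ℚ.+ ∣ c ∣ ℚ.<_) (halves ε) (ℚ.+-mono-< b< c<))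

  interchange : ∀ a b c d → (a ℚ.+ b) - (c ℚ.+ d) ≡ (a - c) ℚ.+ (b - d)
  interchange = solve 4 (λ a b c d →
    (a :+ b) :- (c :+ d) := (a :- c) :+ (b :- d)) refl
    where open ℚ-Solver.+-*-Solver

  telescope : ∀ a b c → a - c ≡ (a - b) ℚ.+ (b - c)
  telescope = solve 3 (λ a b c → a :- c := (a :- b) :+ (b :- c)) refl
    where open ℚ-Solver.+-*-Solver

  flip-sub : ∀ a b → ∣ a - b ∣ ≡ ∣ b - a ∣
  flip-sub a b = trans (cong ∣_∣ (swap a b)) (ℚ.∣-p∣≡∣p∣ (b - a))
    where
    open ℚ-Solver.+-*-Solver
    swap : ∀ a b → a - b ≡ ℚ.- (b - a)
    swap = solve 2 (λ a b → a :- b := :- (b :- a)) refl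

  ∣p-p∣< : ∀ {p q ε} → p ≡ q → 0ℚ ℚ.< ε → ∣ p - q ∣ ℚ.< ε
  ∣p-p∣< {p} {ε = ε} refl =
    subst (λ d → ∣ d ∣ ℚ.< ε) (sym (ℚ.+-inverseʳ p))

  pointwise : ∀ x y → (∀ n → seq x n ≡ seq y n) → x ≈ℝ y
  pointwise x y eq ε 0<ε = 0 , λ n _ → ∣p-p∣< (eq n) 0<ε

0ℝ : ℝ
0ℝ = mkℝ (λ _ → 0ℚ) (λ ε 0<ε → 0 , λ _ _ _ _ → 0<ε)

infixl 6 _+ℝ_
_+ℝ_ : ℝ → ℝ → ℝ
seq    (x +ℝ y) n = seq x n ℚ.+ seq y n
cauchy (x +ℝ y) ε 0<ε =
  let M , p = cauchy x (½ ℚ.* ε) (half-pos 0<ε)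
      N , q = cauchy y (½ ℚ.* ε) (half-pos 0<ε)
  in M ℕ.⊔ N , λ m n M⊔N≤m M⊔N≤n →
    ∣sum∣< (interchange (seq x m) (seq y m) (seq x n) (seq y n))
      (p m n (ℕ.m⊔n≤o⇒m≤o M N M⊔N≤m) (ℕ.m⊔n≤o⇒m≤o M N M⊔N≤n))
      (q m n (ℕ.m⊔n≤o⇒n≤o M N M⊔N≤m) (ℕ.m⊔n≤o⇒n≤o M N M⊔N≤n))

+ℝ-0-commutativeMonoid : CommutativeMonoid 0ℓ 0ℓ
+ℝ-0-commutativeMonoid = record
  { Carrier = ℝ
  ; _≈_     = _≈ℝ_
  ; _∙_     = _+ℝ_
  ; ε       = 0ℝ
  ; isCommutativeMonoid = record
    { isMonoid = record
      { isSemigroup = record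
        { isMagma = record
          { isEquivalence = record
            { refl  = λ {x} → pointwise x x (λ _ → refl)
            ; sym   = λ {x y} → ≈-sym x y
            ; trans = λ {x y z} → ≈-trans x y z
            }
          ; ∙-cong = λ {x y u v} → +-cong x y u v
          }
        ; assoc = λ x y z → pointwise ((x +ℝ y) +ℝ z) (x +ℝ (y +ℝ z))
                    (λ n → ℚ.+-assoc (seq x n) (seq y n) (seq z n))
        }
      ; identity = (λ x → pointwise (0ℝ +ℝ x) x (λ n → ℚ.+-identityˡ (seq x n)))
                 , (λ x → pointwise (x +ℝ 0ℝ) x (λ n → ℚ.+-identityʳ (seq x n)))
      }
    ; comm = λ x y → pointwise (x +ℝ y) (y +ℝ x)
               (λ n → ℚ.+-comm (seq x n) (seq y n))
    }
  }
  where
  ≈-sym : ∀ x y → x ≈ℝ y → y ≈ℝ x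
  ≈-sym x y x≈y ε 0<ε =
    let N , p = x≈y ε 0<ε
    in N , λ n N≤n → subst (ℚ._< ε) (flip-sub (seq x n) (seq y n)) (p n N≤n)

  ≈-trans : ∀ x y z → x ≈ℝ y → y ≈ℝ z → x ≈ℝ z
  ≈-trans x y z x≈y y≈z ε 0<ε =
    let M , p = x≈y (½ ℚ.* ε) (half-pos 0<ε)
        N , q = y≈z (½ ℚ.* ε) (half-pos 0<ε)
    in M ℕ.⊔ N , λ n M⊔N≤n →
      ∣sum∣< (telescope (seq x n) (seq y n) (seq z n))
        (p n (ℕ.m⊔n≤o⇒m≤o M N M⊔N≤n))
        (q n (ℕ.m⊔n≤o⇒n≤o M N M⊔N≤n))

  +-cong : ∀ x y u v → x ≈ℝ y → u ≈ℝ v → x +ℝ u ≈ℝ y +ℝ v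
  +-cong x y u v x≈y u≈v ε 0<ε =
    let M , p = x≈y (½ ℚ.* ε) (half-pos 0<ε)
        N , q = u≈v (½ ℚ.* ε) (half-pos 0<ε)
    in M ℕ.⊔ N , λ n M⊔N≤n →
      ∣sum∣< (interchange (seq x n) (seq u n) (seq y n) (seq v n))
        (p n (ℕ.m⊔n≤o⇒m≤o M N M⊔N≤n))
        (q n (ℕ.m⊔n≤o⇒n≤o M N M⊔N≤n))

-- Complex numbers are pairs (real part , imaginary part); only their
-- equality and addition are needed, and both are componentwise.

+ℂ-0-commutativeMonoid : CommutativeMonoid 0ℓ 0ℓ
+ℂ-0-commutativeMonoid =
  DirectProduct.commutativeMonoid +ℝ-0-commutativeMonoid +ℝ-0-commutativeMonoid

open CommutativeMonoid +ℂ-0-commutativeMonoid public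
  using ()
  renaming (Carrier to ℂ; _≈_ to _≈ℂ_; _∙_ to _+ℂ_; ε to 0ℂ; setoid to ℂ-setoid)

module _ {c ℓ₁ ℓ₂ : Level} (P : Poset c ℓ₁ ℓ₂) where

  open Poset P
  open Membership Eq.setoid using (_∈_)
  open Uniqueness Eq.setoid using (Unique)

  -- S is the set of entries of a repetition-free list.  Everything is up to
  -- the equality _≈_ of P, so a finite S necessarily respects _≈_.

  record Finite {ℓ} (S : Pred Carrier ℓ) : Set (c ⊔ ℓ₁ ⊔ ℓ) where
    field
      elements : List Carrier
      unique   : Unique elements
      ∈⇔       : ∀ x → x ∈ elements ⇔ S x

  open Finite public

  Infinite : ∀ {ℓ} → Pred Carrier ℓ → Set (c ⊔ ℓ₁ ⊔ ℓ)
  Infinite S = ¬ Finite S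

  LocallyFinite : Set (c ⊔ ℓ₁ ⊔ ℓ₂)
  LocallyFinite = ∀ x y → Finite (λ z → x ≤ z × z ≤ y)

  DownFinite : Set (c ⊔ ℓ₁ ⊔ ℓ₂)
  DownFinite = ∀ z → Finite (λ x → x ≤ z)

  -- {x : x ≤ z} is the interval from the minimum to z.

  downFinite : ∀ {0̂} → Minimum _≤_ 0̂ → LocallyFinite → DownFinite
  downFinite {0̂} 0̂-min lf z = record
    { elements = elements (lf 0̂ z)
    ; unique   = unique (lf 0̂ z)
    ; ∈⇔       = λ x → mk⇔
        (λ x∈ → proj₂ (Equivalence.to (∈⇔ (lf 0̂ z) x) x∈))
        (λ x≤z → Equivalence.from (∈⇔ (lf 0̂ z) x) (0̂-min x , x≤z))
    }

  ComplexFunction : Set (c ⊔ ℓ₁)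
  ComplexFunction = Func Eq.setoid ℂ-setoid

  open Func using (to)

  supp : ComplexFunction → Pred Carrier 0ℓ
  supp f x = ¬ (to f x ≈ℂ 0ℂ)

  IdenticallyZero : ComplexFunction → Set c
  IdenticallyZero f = ∀ x → to f x ≈ℂ 0ℂ

  ∑ : ∀ {ℓ} {S : Pred Carrier ℓ} → Finite S → ComplexFunction → ℂ
  ∑ fin f = foldr _+ℂ_ 0ℂ (map (to f) (elements fin))

  -- The disjunction is read classically: it is meant to be used together with
  -- excluded middle, as constructively it would decide which support is infinite.

  MöbiusUncertaintyProperty : DownFinite → Set (c ⊔ ℓ₁)
  MöbiusUncertaintyProperty df =
    ∀ (f g : ComplexFunction) →
    ¬ IdenticallyZero f → ¬ IdenticallyZero g →
    (∀ z → to g z ≈ℂ ∑ (df z) f) →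
    Infinite (supp f) ⊎ Infinite (supp g)

  -- The level of S is the one at which list membership lives, so S ranges
  -- over all finite subsets.

  InfinitelyManyAboveOnlyOne : Set (suc (c ⊔ ℓ₁) ⊔ ℓ₂)
  InfinitelyManyAboveOnlyOne =
    ∀ (S : Pred Carrier (c ⊔ ℓ₁)) → Finite S → ∃ S →
    Σ[ z ∈ Carrier ] S z ×
      Infinite (λ x → x ≥ z × (∀ y → S y → ¬ (y ≈ z) → ¬ (x ≥ y)))

{-# OPTIONS --safe #-}

-- If supp f is finite, apply the hypothesis to S = supp f.  For every x above
-- the resulting z and above no other element of S, the sum for g x has the
-- single nonzero term f z, so these infinitely many x all lie in supp g.

module Submission where

open import Defs
open import Level using (_⊔_; Lift; lift; lower)
open import Algebra.Bundles using (Monoid; CommutativeMonoid)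
open import Axiom.ExcludedMiddle using (ExcludedMiddle)
open import Data.List.Base using (List; []; _∷_; foldr; map; filter)
import Data.List.Membership.Setoid as Membership
import Data.List.Membership.Setoid.Properties as ∈
import Data.List.Relation.Unary.All.Properties as All
open import Data.List.Relation.Unary.AllPairs using (_∷_)
open import Data.List.Relation.Unary.Any using (here; there)
import Data.List.Relation.Unary.Unique.Setoid as Uniqueness
import Data.List.Relation.Unary.Unique.Setoid.Properties as Unique
open import Data.Product.Base using (_×_; _,_; proj₁; proj₂)
open import Data.Sum.Base using (inj₁; inj₂)
open import Function.Base using (_∘_)
open import Function.Bundles using (Func; mk⇔; Equivalence)
open import Relation.Binary.Bundles using (Setoid; Poset)
open import Relation.Binary.Definitions using (Minimum; _Respects_)
import Relation.Binary.Reasoning.Setoid as ≈-Reasoning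
open import Relation.Nullary.Decidable.Core using (yes; no; map′; decidable-stable)
open import Relation.Nullary.Negation.Core using (¬_)
open import Relation.Unary using (Pred; Decidable; _⊆_)

-- Universe levels are not cumulative, so a type of lower level is decided by deciding its `Lift`.
lower-excluded-middle : ∀ {a} b → ExcludedMiddle (a ⊔ b) → ExcludedMiddle a
lower-excluded-middle b em {A} = map′ lower lift (em {Lift b A})

module _ {a ℓ c ℓ′} (A : Setoid a ℓ) (M : Monoid c ℓ′) (f : Func A (Monoid.setoid M)) where

  open Setoid A using (_≈_)
  open Monoid M using (_∙_; ε; ∙-cong; identityˡ; identityʳ)
    renaming (_≈_ to _≈ᴹ_; refl to reflᴹ; trans to transᴹ)
  open Membership A using (_∈_)
  open Uniqueness A using (Unique)
  open Func f using (to; cong)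

  private
    sum : List (Setoid.Carrier A) → Monoid.Carrier M
    sum = foldr _∙_ ε ∘ map to

  sum-zero : ∀ xs → (∀ {y} → y ∈ xs → to y ≈ᴹ ε) → sum xs ≈ᴹ ε
  sum-zero []       _    = reflᴹ
  sum-zero (x ∷ xs) zero =
    transᴹ (∙-cong (zero (here (Setoid.refl A))) (sum-zero xs (zero ∘ there))) (identityˡ ε)

  -- Uniqueness makes the term at `z` count only once. If `z` is the head, a later entry equal to
  -- `z` would repeat the head, so the tail sums to zero; if `z` lies in the tail, the head differs
  -- from `z` and drops out, and induction applies.
  sum-single : ∀ {z xs} → Unique xs → z ∈ xs →
               (∀ {y} → y ∈ xs → ¬ (y ≈ z) → to y ≈ᴹ ε) → sum xs ≈ᴹ to z
  sum-single {z} {x ∷ xs} (x∉xs ∷ _) (here z≈x) zero =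
    transᴹ (∙-cong (cong (Setoid.sym A z≈x)) (sum-zero xs λ y∈xs → zero (there y∈xs) (y≉z y∈xs)))
      (identityʳ (to z))
    where
    y≉z : ∀ {y} → y ∈ xs → ¬ (y ≈ z)
    y≉z y∈xs y≈z = All.All¬⇒¬Any x∉xs
      (∈.∈-resp-≈ A (Setoid.trans A y≈z z≈x) y∈xs)
  sum-single {z} {x ∷ xs} (x∉xs ∷ xs!) (there z∈xs) zero =
    transᴹ (∙-cong (zero (here (Setoid.refl A)) x≉z) (sum-single xs! z∈xs (zero ∘ there)))
      (identityˡ (to z))
    where
    x≉z : ¬ (x ≈ z)
    x≉z x≈z = All.All¬⇒¬Any x∉xs (∈.∈-resp-≈ A (Setoid.sym A x≈z) z∈xs)

module _ {c ℓ₁ ℓ₂} (P : Poset c ℓ₁ ℓ₂) where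

  open Poset P

  -- Filtering the list for `S` by `T?` keeps it free of repetitions. `T` is asked to respect `_≈_`
  -- because list membership is only up to `_≈_`.
  ⊆-finite : ∀ {s t} {S : Pred Carrier s} {T : Pred Carrier t} →
             Decidable T → T Respects _≈_ → T ⊆ S → Finite P S → Finite P T
  ⊆-finite T? T-resp T⊆S fin = record
    { elements = filter T? (elements fin)
    ; unique   = Unique.filter⁺ Eq.setoid T? (unique fin)
    ; ∈⇔       = λ x → mk⇔
        (proj₂ ∘ ∈.∈-filter⁻ Eq.setoid T? T-resp {xs = elements fin})
        (λ Tx → ∈.∈-filter⁺ Eq.setoid T? T-resp
                  (Equivalence.from (∈⇔ fin x) (T⊆S Tx)) Tx)
    }

  -- The hypothesis on finite subsets speaks of predicates at one fixed level; this brings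
  -- `supp P f`, which lives at the lowest level, up to it.
  lift-finite : ∀ {s} t {S : Pred Carrier s} → Finite P S → Finite P (Lift t ∘ S)
  lift-finite t fin = record
    { elements = elements fin
    ; unique   = unique fin
    ; ∈⇔       = λ x → mk⇔ (lift ∘ Equivalence.to (∈⇔ fin x))
                           (Equivalence.from (∈⇔ fin x) ∘ lower)
    }

theorem1p2 : ∀ {c ℓ₁ ℓ₂} → ExcludedMiddle (c ⊔ ℓ₁ ⊔ ℓ₂) →
    (P : Poset c ℓ₁ ℓ₂) (0̂ : Poset.Carrier P) →
    (0̂-min : Minimum (Poset._≤_ P) 0̂) (lf : LocallyFinite P) →
    InfinitelyManyAboveOnlyOne P →
    MöbiusUncertaintyProperty P (downFinite P 0̂-min lf)
theorem1p2 {c} {ℓ₁} {ℓ₂} em P 0̂ 0̂-min lf above f g f≢0 _ g≈∑f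
  with lower-excluded-middle ℓ₂ em {Finite P (supp P f)}
... | no  inf = inj₁ inf
-- Finiteness of `supp P g` is refuted by showing that every `f x` would vanish. Assuming `f x`
-- nonzero supplies the inhabitant of `S` that `above` asks for.
... | yes fin = inj₂ λ fin′ → f≢0 λ x → ≈0-stable (Func.to f x) λ fx≉0 →
        let z , lift fz≉0 , inf = above S (lift-finite P (c ⊔ ℓ₁) fin) (x , lift fx≉0)
        -- The set that `above` declares infinite lies inside `supp P g`, so excluded middle can
        -- filter it out of the finite list `fin′`.
        in inf (⊆-finite P (λ _ → em) (resp z) (∈supp-g fz≉0) fin′)
  where
  open Poset P
  open Func using (to)
  module ℂ = CommutativeMonoid +ℂ-0-commutativeMonoid

  S : Pred Carrier (c ⊔ ℓ₁)
  S = Lift (c ⊔ ℓ₁) ∘ supp P f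

  AboveOnly : Carrier → Pred Carrier (c ⊔ ℓ₁ ⊔ ℓ₂)
  AboveOnly z x = x ≥ z × (∀ y → S y → ¬ (y ≈ z) → ¬ (x ≥ y))

  -- `supp` is defined by a negation, so lying outside it gives only the double negation of
  -- vanishing.
  ≈0-stable : ∀ w → ¬ ¬ (w ≈ℂ 0ℂ) → w ≈ℂ 0ℂ
  ≈0-stable _ = decidable-stable (lower-excluded-middle (c ⊔ ℓ₁ ⊔ ℓ₂) em)

  resp : ∀ z → AboveOnly z Respects _≈_
  resp z x≈x′ (z≤x , ≱) =
    trans z≤x (reflexive x≈x′) , λ y Sy y≉z y≤x′ → ≱ y Sy y≉z (trans y≤x′ (reflexive (Eq.sym x≈x′)))

  ∈supp-g : ∀ {z} → supp P f z → AboveOnly z ⊆ supp P g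
  ∈supp-g {z} fz≉0 {x} (z≤x , ≱) gx≈0 = fz≉0 (begin
    to f z    ≈⟨ sum-single Eq.setoid ℂ.monoid f (unique ↓x) (Equivalence.from (∈⇔ ↓x z) z≤x) f≈0 ⟨
    ∑ P ↓x f  ≈⟨ g≈∑f x ⟨
    to g x    ≈⟨ gx≈0 ⟩
    0ℂ        ∎)
    where
    open ≈-Reasoning ℂ-setoid
    open Membership Eq.setoid using (_∈_)
    ↓x = downFinite P 0̂-min lf x

    f≈0 : ∀ {y} → y ∈ elements ↓x → ¬ (y ≈ z) → to f y ≈ℂ 0ℂ
    -- Otherwise `y` would be an element of `S` other than `z` and below `x`, which `≱` forbids.
    f≈0 {y} y∈↓x y≉z = ≈0-stable (to f y) λ fy≉0 →
      ≱ y (lift fy≉0) y≉z (Equivalence.to (∈⇔ ↓x y) y∈↓x)
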